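{- Let $n \geq 6$. Consider the position of $n$-Sim in which exactly three edges are coloured, and for some four distinct vertices $a,b,c,d$ these are: $ab$ and $bc$, coloured green, and $cd$, coloured red; it is PII's turn to move. Then this position is a PII win.
   Context: The game $n$-Sim: the board is the complete graph on $n$ vertices. Two players, PI and PII, alternately colour one previously uncoloured edge, PI moving first; PI colours edges green and PII colours edges red. The first player to complete a triangle all of whose edges are in his own colour loses (the game ends immediately). If all edges are coloured with no monochromatic triangle, the game is a draw (this cannot happen for $n\ge 6$). A position is a partial colouring of the edges by green and red containing no monochromatic triangle. The player to move is determined by the edge counts: PI moves if the numbers of green and red edges are equal, and PII moves if there is exactly one more green edge than red. A position is a "PII win" (respectively "PI win") if PII (respectively PI) has a winning strategy when play continues from that position. -}

module Defs where

open import Data.Nat using (ℕ; suc)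
open import Data.Fin using (Fin; _<?_)
open import Data.Fin.Properties using (_≟_)
open import Data.Bool using (if_then_else_)
open import Data.List using (List; length; filter; allFin; cartesianProduct)
open import Data.Maybe using (Maybe; just; nothing)
import Data.Maybe.Properties as Maybe
open import Data.Product using (_×_; _,_; proj₁; proj₂; ∃-syntax; swap)
open import Data.Sum using (_⊎_; inj₁; inj₂)
open import Function.Bundles using (mk⇔)
open import Relation.Binary.Definitions using (DecidableEquality)
open import Relation.Binary.PropositionalEquality
  using (_≡_; _≢_; refl; sym; trans; cong; cong₂)
open import Relation.Nullary using (¬_; Dec; yes; no; does)
open import Relation.Nullary.Decidable using (_×-dec_; _⊎-dec_; does-⇔; dec-false)

data Colour : Set where
  green red : Colour

_≟ᶜ_ : DecidableEquality Colour
green ≟ᶜ green = yes refl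
green ≟ᶜ red   = no λ ()
red   ≟ᶜ green = no λ ()
red   ≟ᶜ red   = yes refl

data Player : Set where
  PI PII : Player

opponent : Player → Player
opponent PI  = PII
opponent PII = PI

ink : Player → Colour
ink PI  = green
ink PII = red

-- {x , y} and {u , v} are the same unordered pair.
SameEdge : ∀ {n} → (x y u v : Fin n) → Set
SameEdge x y u v = (x ≡ u × y ≡ v) ⊎ (x ≡ v × y ≡ u)

sameEdge? : ∀ {n} (x y u v : Fin n) → Dec (SameEdge x y u v)
sameEdge? x y u v = (x ≟ u ×-dec y ≟ v) ⊎-dec (x ≟ v ×-dec y ≟ u)

-- A partial colouring of the edges of the complete graph on Fin n, as a
-- symmetric function of the two endpoints; the diagonal (not an edge) is
-- never coloured.
record Colouring (n : ℕ) : Set where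
  field
    colour    : Fin n → Fin n → Maybe Colour
    symmetric : ∀ u v → colour u v ≡ colour v u
    loopless  : ∀ v → colour v v ≡ nothing

open Colouring public

Uncoloured : ∀ {n} → Colouring n → Fin n → Fin n → Set
Uncoloured c u v = u ≢ v × colour c u v ≡ nothing

UncolouredEdge : ∀ {n} → Colouring n → Set
UncolouredEdge c = ∃[ u ] ∃[ v ] Uncoloured c u v

paint : ∀ {n} → Colour → (c : Colouring n) → UncolouredEdge c → Colouring n
paint {n} k c (u , v , u≢v , _) = record
  { colour = col ; symmetric = col-sym ; loopless = col-loop }
  where
  col : Fin n → Fin n → Maybe Colour
  col x y = if does (sameEdge? x y u v) then just k else colour c x y

  flip-edge : ∀ {x y} → SameEdge x y u v → SameEdge y x u v
  flip-edge (inj₁ p) = inj₂ (swap p)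
  flip-edge (inj₂ p) = inj₁ (swap p)

  col-sym : ∀ x y → col x y ≡ col y x
  col-sym x y = cong₂ (λ b m → if b then just k else m)
    (does-⇔ (mk⇔ flip-edge flip-edge) (sameEdge? x y u v) (sameEdge? y x u v))
    (symmetric c x y)

  col-loop : ∀ x → col x x ≡ nothing
  col-loop x = trans
    (cong (λ b → if b then just k else colour c x x)
          (dec-false (sameEdge? x x u v) not-loop))
    (loopless c x)
    where
    not-loop : ¬ SameEdge x x u v
    not-loop (inj₁ (p , q)) = u≢v (trans (sym p) q)
    not-loop (inj₂ (p , q)) = u≢v (trans (sym q) p)

-- By looplessness the three vertices are automatically distinct.
Triangle : ∀ {n} → Colour → Colouring n → Set
Triangle k c = ∃[ x ] ∃[ y ] ∃[ z ]
  (colour c x y ≡ just k × colour c y z ≡ just k × colour c x z ≡ just k)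

NoMonoTriangle : ∀ {n} → Colouring n → Set
NoMonoTriangle c = ∀ k → ¬ Triangle k c

-- Each edge is counted once, with its endpoints in increasing order.
edgeCount : ∀ {n} → Colour → Colouring n → ℕ
edgeCount {n} k c = length
  (filter (λ e → (proj₁ e <? proj₂ e)
                   ×-dec Maybe.≡-dec _≟ᶜ_ (colour c (proj₁ e) (proj₂ e)) (just k))
          (cartesianProduct (allFin n) (allFin n)))

ToMove : ∀ {n} → Player → Colouring n → Set
ToMove PI  c = edgeCount green c ≡ edgeCount red c
ToMove PII c = edgeCount green c ≡ suc (edgeCount red c)

record Position (n : ℕ) : Set where
  field
    colouring  : Colouring n
    noTriangle : NoMonoTriangle colouring
    mover      : Player
    isToMove   : ToMove mover colouring

open Position public

-- The game continues until a monochromatic triangle appears or the board is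
-- full.
Ongoing : ∀ {n} → Colouring n → Set
Ongoing c = NoMonoTriangle c × UncolouredEdge c

Strategy : ℕ → Set
Strategy n = (c : Colouring n) → Ongoing c → UncolouredEdge c

-- Play w σ P m c: when w follows σ and the opponent moves arbitrarily, play
-- from P can reach the colouring c with m next in turn.  The colouring c may
-- be final: the last move of a play may complete a triangle.
data Play {n : ℕ} (w : Player) (σ : Strategy n) (P : Position n) :
          Player → Colouring n → Set where
  start  : Play w σ P (mover P) (colouring P)
  follow : ∀ {c} → Play w σ P w c → (o : Ongoing c) →
           Play w σ P (opponent w) (paint (ink w) c (σ c o))
  reply  : ∀ {c} → Play w σ P (opponent w) c → Ongoing c →
           (e : UncolouredEdge c) →
           Play w σ P w (paint (ink (opponent w)) c e)

-- Every finished play ends with a triangle of the opponent's.  Plays stop at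
-- the first monochromatic triangle, so w has then completed none; full boards
-- without a triangle are draws and hence not won.  Every move colours a new
-- edge, so every play does finish.
Winning : ∀ {n} → Player → Strategy n → Position n → Set
Winning w σ P = ∀ {m c} → Play w σ P m c → ¬ Ongoing c →
                Triangle (ink (opponent w)) c

IsWinFor : ∀ {n} → Player → Position n → Set
IsWinFor {n} w P = ∃[ σ ] Winning {n} w σ P

-- Exactly three edges are coloured: ab and bc green, cd red.
GreenPathRedTail : ∀ {n} → Colouring n → (a b c d : Fin n) → Set
GreenPathRedTail κ a b c d =
    colour κ a b ≡ just green
  × colour κ b c ≡ just green
  × colour κ c d ≡ just red
  × (∀ x y → colour κ x y ≢ nothing →
       SameEdge x y a b ⊎ SameEdge x y b c ⊎ SameEdge x y c d)

{-# OPTIONS --safe #-}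
-- The proof is strategy stealing.  Let Y be the position after PII answers
-- with bd.  If Y is lost for PI, who is to move in it, PII plays bd.
-- Otherwise, exchanging the colours in Y and renaming a, b, c, d to
-- d, c, a, b gives a position that PII wins moving first: the given position
-- with the extra red edge ac.  PII then follows that winning strategy,
-- pretending that ac is red already: PI can never take ac, which would
-- complete the green triangle abc, and one red edge fewer does not hurt PII.
-- Since R(3,3) = 6 there are no draws, so in each position one of the players
-- wins, and PII never runs out of moves in the pretended game.
module Submission where

open import Defs
open import Data.Nat using (ℕ; suc; _≤_; _<_; _≥_; s≤s⁻¹)
open import Data.Nat.Properties using (≤-refl; <-≤-trans)
open import Data.Fin as Fin using (Fin; inject≤)
open import Data.Fin.Properties
  using (_≟_; any?; <⇒≢; <-trans; suc-injective; inject≤-injective)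
open import Data.Fin.Permutation as Perm
  using (Permutation′; _⟨$⟩ʳ_; _⟨$⟩ˡ_; inverseʳ; transpose; _∘ₚ_)
open import Data.Fin.Subset.Properties using (anySubset?)
open import Data.Bool using (Bool)
import Data.Bool.Properties as Bool
open import Data.List using (List; _∷_; []; length; filter; allFin; cartesianProduct)
open import Data.List.Properties using (filter-notAll)
open import Data.List.Membership.Propositional using (_∈_; lose)
open import Data.List.Membership.Propositional.Properties
  using (∈-filter⁺; ∈-allFin; ∈-cartesianProduct⁺)
open import Data.List.Relation.Unary.All as All using ([]; _∷_)
open import Data.List.Relation.Unary.AllPairs as AllPairs using ([]; _∷_)
open import Data.List.Relation.Unary.Unique.Propositional using (Unique)
open import Data.Maybe using (just; nothing)
open import Data.Maybe.Properties using (just-injective) renaming (≡-dec to ≡-decᵐ)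
open import Data.Product using (_×_; _,_; proj₁; proj₂; ∃-syntax)
open import Data.Product.Properties using () renaming (≡-dec to ≡-decˣ)
open import Data.Sum as Sum using (_⊎_; inj₁; inj₂)
open import Data.Vec using (Vec; lookup; tabulate)
open import Data.Vec.Properties using (lookup∘tabulate)
open import Function.Base using (_∘_)
open import Function.Bundles using (Injection)
open import Function.Properties.Inverse using (↔⇒↣)
open import Relation.Binary.PropositionalEquality
  using (_≡_; _≢_; ≢-sym; refl; sym; trans; cong; subst)
open import Relation.Nullary
  using (¬_; Dec; yes; no; does; contradiction)
open import Relation.Nullary.Decidable
  using (_×-dec_; ¬?; dec-true; dec-false; decidable-stable; toWitnessFalse)

private variable
  n : ℕ
  k l k′ l′ : Colour

-- Decidability, and painting an edge

triangle? : ∀ k (c : Colouring n) → Dec (Triangle k c)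
triangle? k c = any? λ x → any? λ y → any? λ z →
  coloured? x y ×-dec coloured? y z ×-dec coloured? x z
  where
  coloured? : ∀ x y → Dec (colour c x y ≡ just k)
  coloured? x y = ≡-decᵐ _≟ᶜ_ (colour c x y) (just k)

uncoloured? : ∀ (c : Colouring n) u v → Dec (Uncoloured c u v)
uncoloured? c u v = ¬? (u ≟ v) ×-dec ≡-decᵐ _≟ᶜ_ (colour c u v) nothing

noMono : ∀ (c : Colouring n) → ¬ Triangle green c → ¬ Triangle red c → NoMonoTriangle c
noMono c ng nr green = ng
noMono c ng nr red   = nr

sameEdge-colour : ∀ (c : Colouring n) {x y u v m} → SameEdge x y u v →
                  colour c u v ≡ m → colour c x y ≡ m
sameEdge-colour c (inj₁ (refl , refl)) eq = eq
sameEdge-colour c (inj₂ (refl , refl)) eq = trans (symmetric c _ _) eq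

module _ (k : Colour) (c : Colouring n) (e : UncolouredEdge c) where
  private
    u = proj₁ e
    v = proj₁ (proj₂ e)
    fresh = proj₂ (proj₂ (proj₂ e))

  paint-same : ∀ {x y} → SameEdge x y u v → colour (paint k c e) x y ≡ just k
  paint-same {x} {y} same rewrite dec-true (sameEdge? x y u v) same = refl

  paint-other : ∀ {x y} → ¬ SameEdge x y u v → colour (paint k c e) x y ≡ colour c x y
  paint-other {x} {y} other rewrite dec-false (sameEdge? x y u v) other = refl

  paint-keeps : ∀ {x y j} → colour c x y ≡ just j → colour (paint k c e) x y ≡ just j
  paint-keeps {x} {y} eq with sameEdge? x y u v
  ... | no other = trans (paint-other other) eq
  ... | yes same with trans (sym eq) (sameEdge-colour c same fresh)
  ...   | ()

  paint-uncoloured : ∀ {x y} → Uncoloured (paint k c e) x y → Uncoloured c x y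
  paint-uncoloured {x} {y} (x≢y , eq) with sameEdge? x y u v
  ... | no other = x≢y , trans (sym (paint-other other)) eq
  ... | yes same = contradiction (trans (sym (paint-same same)) eq) λ ()

  paint-origin : ∀ {x y j} → colour (paint k c e) x y ≡ just j →
                 SameEdge x y u v × j ≡ k ⊎ colour c x y ≡ just j
  paint-origin {x} {y} eq with sameEdge? x y u v
  ... | yes same = inj₁ (same , just-injective (trans (sym eq) (paint-same same)))
  ... | no other = inj₂ (trans (sym (paint-other other)) eq)

  paint-triangle : Triangle k c → Triangle k (paint k c e)
  paint-triangle (x , y , z , p , q , r) =
    x , y , z , paint-keeps p , paint-keeps q , paint-keeps r

-- Winning positions as well-founded trees

-- Wins k l c (Holds k l c): the owner of k wins against the owner of l when he
-- (his opponent) is next to move.  A full board counts as a loss for the player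
-- to move; boards without a monochromatic triangle are never full for n ≥ 6.
data Wins  {n} (k l : Colour) (c : Colouring n) : Set
data Holds {n} (k l : Colour) (c : Colouring n) : Set

data Wins k l c where
  move : (e : UncolouredEdge c) → ¬ Triangle k (paint k c e) →
         Holds k l (paint k c e) → Wins k l c

data Holds k l c where
  hold : ((e : UncolouredEdge c) → ¬ Triangle l (paint l c e) →
          Wins k l (paint l c e)) → Holds k l c

-- Simulating one board on another

-- If k wins against l on c, then k′ wins against l′ on d by playing as on c,
-- with the vertices renamed by τ.  Edges coloured on c may be uncoloured
-- on d if l′ cannot play them without completing a triangle.
record Simulates (τ : Permutation′ n) (k l : Colour) (c : Colouring n)
                 (k′ l′ : Colour) (d : Colouring n) : Set where
  field
    free   : ∀ {x y} → colour c (τ ⟨$⟩ʳ x) (τ ⟨$⟩ʳ y) ≡ nothing →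
             colour d x y ≡ nothing
    own    : ∀ {x y} → colour d x y ≡ just k′ →
             colour c (τ ⟨$⟩ʳ x) (τ ⟨$⟩ʳ y) ≡ just k
    theirs : ∀ {x y} → colour c (τ ⟨$⟩ʳ x) (τ ⟨$⟩ʳ y) ≡ just l →
             colour d x y ≡ just l′
    closed : ∀ {x y} → x ≢ y → colour d x y ≡ nothing →
             colour c (τ ⟨$⟩ʳ x) (τ ⟨$⟩ʳ y) ≡ nothing ⊎
             ∃[ z ] colour d x z ≡ just l′ × colour d z y ≡ just l′

permuted-injective : ∀ (τ : Permutation′ n) {x y} → τ ⟨$⟩ʳ x ≡ τ ⟨$⟩ʳ y → x ≡ y
permuted-injective τ = Injection.injective (↔⇒↣ τ)

permuted-sameEdge : ∀ (τ : Permutation′ n) {x y u v u′ v′} →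
                    τ ⟨$⟩ʳ u ≡ u′ → τ ⟨$⟩ʳ v ≡ v′ →
                    SameEdge (τ ⟨$⟩ʳ x) (τ ⟨$⟩ʳ y) u′ v′ → SameEdge x y u v
permuted-sameEdge τ refl refl = Sum.map both both
  where
  both : ∀ {x y u v} → τ ⟨$⟩ʳ x ≡ τ ⟨$⟩ʳ u × τ ⟨$⟩ʳ y ≡ τ ⟨$⟩ʳ v → x ≡ u × y ≡ v
  both (p , q) = permuted-injective τ p , permuted-injective τ q

sameEdge-permuted : ∀ (τ : Permutation′ n) {x y u v u′ v′} →
                    τ ⟨$⟩ʳ u ≡ u′ → τ ⟨$⟩ʳ v ≡ v′ →
                    SameEdge x y u v → SameEdge (τ ⟨$⟩ʳ x) (τ ⟨$⟩ʳ y) u′ v′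
sameEdge-permuted τ refl refl (inj₁ (refl , refl)) = inj₁ (refl , refl)
sameEdge-permuted τ refl refl (inj₂ (refl , refl)) = inj₂ (refl , refl)

module _ {τ : Permutation′ n} {k l k′ l′ : Colour} {c d : Colouring n} where

  -- The boards advance in step: a move in `k` is matched by one in `k′`, a move in `l` by one in
  -- `l′`, and the two implications cover both cases. `closed` survives because painting erases no
  -- edge of the path that justified it.
  Simulates-paint : Simulates τ k l c k′ l′ d →
    ∀ {p p′} → (k′ ≡ p′ → k ≡ p) → (l ≡ p → l′ ≡ p′) →
    ∀ {u v} (e : Uncoloured c (τ ⟨$⟩ʳ u) (τ ⟨$⟩ʳ v)) (e′ : Uncoloured d u v) →
    Simulates τ k l (paint p c (_ , _ , e)) k′ l′ (paint p′ d (_ , _ , e′))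
  Simulates-paint S {p} {p′} own-p theirs-p {u} {v} e e′ = record
    { free = free′ ; own = own′ ; theirs = theirs′ ; closed = closed′ }
    where
    open Simulates S
    c′ = paint p  c (_ , _ , e)
    d′ = paint p′ d (_ , _ , e′)

    painted : ∀ x y →
      (colour c′ (τ ⟨$⟩ʳ x) (τ ⟨$⟩ʳ y) ≡ just p × colour d′ x y ≡ just p′) ⊎
      (colour c′ (τ ⟨$⟩ʳ x) (τ ⟨$⟩ʳ y) ≡ colour c (τ ⟨$⟩ʳ x) (τ ⟨$⟩ʳ y) ×
       colour d′ x y ≡ colour d x y)
    painted x y with sameEdge? x y u v
    ... | yes same  = inj₁
          ( paint-same p c (_ , _ , e) (sameEdge-permuted τ refl refl same)
          , paint-same p′ d (_ , _ , e′) same )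
    ... | no  other = inj₂
          ( paint-other p c (_ , _ , e) (other ∘ permuted-sameEdge τ refl refl)
          , paint-other p′ d (_ , _ , e′) other )

    free′ : ∀ {x y} → colour c′ (τ ⟨$⟩ʳ x) (τ ⟨$⟩ʳ y) ≡ nothing → colour d′ x y ≡ nothing
    free′ {x} {y} eq with painted x y
    ... | inj₁ (cp , _)  = contradiction (trans (sym cp) eq) λ ()
    ... | inj₂ (cs , ds) = trans ds (free (trans (sym cs) eq))

    own′ : ∀ {x y} → colour d′ x y ≡ just k′ → colour c′ (τ ⟨$⟩ʳ x) (τ ⟨$⟩ʳ y) ≡ just k
    own′ {x} {y} eq with painted x y
    ... | inj₁ (cp , dp) =
          trans cp (cong just (sym (own-p (just-injective (trans (sym eq) dp)))))
    ... | inj₂ (cs , ds) = trans cs (own (trans (sym ds) eq))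

    theirs′ : ∀ {x y} → colour c′ (τ ⟨$⟩ʳ x) (τ ⟨$⟩ʳ y) ≡ just l → colour d′ x y ≡ just l′
    theirs′ {x} {y} eq with painted x y
    ... | inj₁ (cp , dp) =
          trans dp (cong just (sym (theirs-p (just-injective (trans (sym eq) cp)))))
    ... | inj₂ (cs , ds) = trans ds (theirs (trans (sym cs) eq))

    closed′ : ∀ {x y} → x ≢ y → colour d′ x y ≡ nothing →
              colour c′ (τ ⟨$⟩ʳ x) (τ ⟨$⟩ʳ y) ≡ nothing ⊎
              ∃[ z ] colour d′ x z ≡ just l′ × colour d′ z y ≡ just l′
    closed′ {x} {y} x≢y eq with painted x y
    ... | inj₁ (_ , dp)  = contradiction (trans (sym dp) eq) λ ()
    ... | inj₂ (cs , ds) = Sum.map (trans cs)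
          (λ (z , xz , zy) → z , keeps xz , keeps zy)
          (closed x≢y (trans (sym ds) eq))
      where keeps = λ {x y} → paint-keeps p′ d (_ , _ , e′) {x} {y}

  -- `own` and `theirs` point in opposite directions so that safety passes the right way: the
  -- simulating player's safe moves on `c` are safe on `d`, and the opponent's safe replies on `d`
  -- are safe on `c`.
  Simulates-own-triangle : Simulates τ k l c k′ l′ d → Triangle k′ d → Triangle k c
  Simulates-own-triangle S (x , y , z , p , q , r) = _ , _ , _ , own p , own q , own r
    where open Simulates S

  Simulates-their-triangle : Simulates τ k l c k′ l′ d → Triangle l c → Triangle l′ d
  Simulates-their-triangle S (x , y , z , p , q , r) =
    _ , _ , _ , theirs′ p , theirs′ q , theirs′ r
    where
    open Simulates S
    theirs′ : ∀ {x y} → colour c x y ≡ just l → colour d (τ ⟨$⟩ˡ x) (τ ⟨$⟩ˡ y) ≡ just l′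
    theirs′ eq = theirs (subst (λ w → colour c w _ ≡ _) (sym (inverseʳ τ))
                   (subst (λ w → colour c _ w ≡ _) (sym (inverseʳ τ)) eq))

module _ {τ : Permutation′ n} {k l k′ l′ : Colour} (k≢l : k ≢ l) (k′≢l′ : k′ ≢ l′) where

  simulate-Wins : ∀ {c d} → Simulates τ k l c k′ l′ d → Wins k l c → Wins k′ l′ d
  simulate-Holds : ∀ {c d} → Simulates τ k l c k′ l′ d → Holds k l c → Holds k′ l′ d

  simulate-Wins {c} {d} S (move (x , y , x≢y , xy) safe h)
    -- The winning move is pulled back along `τ`; matching on `refl` turns its endpoints into the
    -- images of `u` and `v`.
    with τ ⟨$⟩ˡ x | inverseʳ τ {x} | τ ⟨$⟩ˡ y | inverseʳ τ {y}
  ... | u | refl | v | refl =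
    move (u , v , e′) (safe ∘ Simulates-own-triangle S′) (simulate-Holds S′ h)
    where
    e′ : Uncoloured d u v
    e′ = x≢y ∘ cong (τ ⟨$⟩ʳ_) , Simulates.free S xy
    S′ = Simulates-paint S (λ _ → refl) (λ eq → contradiction (sym eq) k≢l) (x≢y , xy) e′

  simulate-Holds {c} {d} S (hold h) = hold answer
    where
    answer : (e : UncolouredEdge d) → ¬ Triangle l′ (paint l′ d e) →
             Wins k′ l′ (paint l′ d e)
    answer (u , v , u≢v , uv) safe with Simulates.closed S u≢v uv
    -- The path through `z` makes this reply complete a triangle in `l′`, so it needs no counterpart
    -- on `c`.
    ... | inj₂ (z , uz , zv) = contradiction
          (u , z , v , paint-keeps l′ d e uz , paint-keeps l′ d e zv
          , paint-same l′ d e (inj₁ (refl , refl))) safe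
      where e = u , v , u≢v , uv
    ... | inj₁ open′ =
      simulate-Wins S′ (h (_ , _ , e) (safe ∘ Simulates-their-triangle S′))
      where
      e : Uncoloured c (τ ⟨$⟩ʳ u) (τ ⟨$⟩ʳ v)
      e = u≢v ∘ permuted-injective τ , open′
      S′ = Simulates-paint S (λ eq → contradiction eq k′≢l′) (λ _ → refl) e (u≢v , uv)

-- Painting the same edge under two proofs that it is uncoloured gives boards with equal colours
-- that need not be the same record.
Wins-cong : k ≢ l → ∀ {c d : Colouring n} →
            (∀ x y → colour c x y ≡ colour d x y) → Wins k l c → Wins k l d
Wins-cong k≢l same = simulate-Wins {τ = Perm.id} k≢l k≢l record
  { free   = λ {x} {y} eq → trans (sym (same x y)) eq
  ; own    = λ {x} {y} eq → trans (same x y) eq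
  ; theirs = λ {x} {y} eq → trans (sym (same x y)) eq
  ; closed = λ {x} {y} _ eq → inj₁ (trans (same x y) eq) }

-- Determinacy

-- Played against each other, the two strategies would both always have a safe move, so play would
-- never end; but both trees are well founded.
Wins-exclusive : {c : Colouring n} → Wins k l c → ¬ Holds l k c
Wins-exclusive (move e safe (hold h)) (hold g) with g e safe
... | move e′ safe′ h′ = Wins-exclusive (h e′ safe′) h′

∃⊎∀ : {A B : Fin n → Set} → (∀ i → A i ⊎ B i) → (∃[ i ] A i) ⊎ (∀ i → B i)
∃⊎∀ {n = 0}     f = inj₂ λ ()
∃⊎∀ {n = suc n} f with f Fin.zero | ∃⊎∀ (f ∘ Fin.suc)
... | inj₁ a | _            = inj₁ (Fin.zero , a)
... | inj₂ _ | inj₁ (i , a) = inj₁ (Fin.suc i , a)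
... | inj₂ b | inj₂ bs      = inj₂ λ { Fin.zero → b ; (Fin.suc i) → bs i }

-- Zermelo's backward induction. The measure is the length of a list containing all uncoloured
-- pairs, from which each move deletes a pair. Pairs are ordered, so the reverse of a painted pair
-- may linger in the list, which does no harm.
determined-within : k ≢ l → ∀ m (edges : List (Fin n × Fin n)) → length edges < m →
  (c : Colouring n) → (∀ {u v} → Uncoloured c u v → (u , v) ∈ edges) →
  Wins k l c ⊎ Holds l k c
determined-within {k = k} {l} {n} k≢l (suc m) edges fits c covers =
  Sum.map (λ (u , v , e , safe , h) → move (u , v , e) safe h)
          (λ lost → hold λ (u , v , e) → lost u v e)
          (∃⊎∀ λ u → ∃⊎∀ λ v → try u v)
  where
  Good Bad : Fin n → Fin n → Set
  Good u v = ∃[ e ] ¬ Triangle k (paint k c (u , v , e)) × Holds k l (paint k c (u , v , e))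
  Bad u v = (e : Uncoloured c u v) → ¬ Triangle k (paint k c (u , v , e)) →
            Wins l k (paint k c (u , v , e))

  try : ∀ u v → Good u v ⊎ Bad u v
  try u v with uncoloured? c u v
  ... | no taken = inj₂ λ e → contradiction e taken
  ... | yes e with triangle? k (paint k c (u , v , e))
  -- A move completing a triangle of the mover's own loses at once, so it makes no demand on the
  -- opponent.
  ...   | yes tri = inj₂ λ _ safe → contradiction tri safe
  ...   | no safe with determined-within (k≢l ∘ sym) m (filter other? edges) shorter
                         (paint k c (u , v , e)) covers′
    where
    other? : ∀ f → Dec (f ≢ (u , v))
    other? f = ¬? (≡-decˣ _≟_ _≟_ f (u , v))
    shorter : length (filter other? edges) < m
    shorter = <-≤-trans (filter-notAll other? edges (lose (covers e) λ neq → neq refl))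
                        (s≤s⁻¹ fits)
    covers′ : ∀ {x y} → Uncoloured (paint k c (u , v , e)) x y → (x , y) ∈ filter other? edges
    covers′ e′ = ∈-filter⁺ other? (covers (paint-uncoloured k c (u , v , e) e′))
      λ { refl → contradiction
            (trans (sym (paint-same k c (u , v , e) (inj₁ (refl , refl)))) (proj₂ e′)) λ () }
  ...     | inj₂ h = inj₁ (e , safe , h)
  ...     | inj₁ w = inj₂ λ _ _ → Wins-cong (k≢l ∘ sym) (λ _ _ → refl) w

determined : k ≢ l → (c : Colouring n) → Wins k l c ⊎ Holds l k c
determined {n = n} k≢l c = determined-within k≢l _
  (cartesianProduct (allFin n) (allFin n)) ≤-refl c
  λ {u} {v} _ → ∈-cartesianProduct⁺ (∈-allFin u) (∈-allFin v)

-- Ramsey's theorem R(3,3) ≤ 6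

-- Pigeonhole, settled by evaluation: a subset of `Fin 5` is a Boolean vector of length 5, so
-- `anySubset?` searches all 32 of them for a counterexample.
three-alike : ∀ (f : Fin 5 → Bool) →
  ∃[ i ] ∃[ j ] ∃[ k ] i Fin.< j × j Fin.< k × f i ≡ f j × f j ≡ f k
three-alike f with alike (tabulate f)
  where
  Alike : Vec Bool 5 → Set
  Alike s = ∃[ i ] ∃[ j ] ∃[ k ]
    i Fin.< j × j Fin.< k × lookup s i ≡ lookup s j × lookup s j ≡ lookup s k
  alike? : ∀ s → Dec (Alike s)
  alike? s = any? λ i → any? λ j → any? λ k →
    i Fin.<? j ×-dec j Fin.<? k ×-dec
    lookup s i Bool.≟ lookup s j ×-dec lookup s j Bool.≟ lookup s k
  alike : ∀ s → Alike s
  alike s = decidable-stable (alike? s) λ unalike →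
    toWitnessFalse {a? = anySubset? (¬? ∘ alike?)} _ (s , unalike)
... | i , j , k , i<j , j<k , p , q = i , j , k , i<j , j<k , via p , via q
  where
  via : ∀ {i j} → lookup (tabulate f) i ≡ lookup (tabulate f) j → f i ≡ f j
  via {i} {j} eq = trans (sym (lookup∘tabulate f i)) (trans eq (lookup∘tabulate f j))

Complete : Colouring n → Set
Complete c = ∀ {x y} → x ≢ y → ∃[ k ] colour c x y ≡ just k

both-differ : ∀ {i j} → i ≢ k → j ≢ k → i ≡ j
both-differ         {i = green} {green} _ _ = refl
both-differ         {i = red}   {red}   _ _ = refl
both-differ {green} {i = green} {red}   p _ = contradiction refl p
both-differ {red}   {i = green} {red}   _ q = contradiction refl q
both-differ {green} {i = red}   {green} _ q = contradiction refl q
both-differ {red}   {i = red}   {green} p _ = contradiction refl p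

-- Either an edge among x, y, z has colour k too, or all three have the other
-- colour.
triangle-from-claw : ∀ {c : Colouring n} → Complete c → ∀ {o x y z} →
  x ≢ y → y ≢ z → x ≢ z →
  colour c o x ≡ just k → colour c o y ≡ just k → colour c o z ≡ just k →
  ¬ NoMonoTriangle c
triangle-from-claw {k = k} full x≢y y≢z x≢z ox oy oz none
  with full x≢y | full y≢z | full x≢z
... | i , xy | j , yz | m , xz with i ≟ᶜ k | j ≟ᶜ k | m ≟ᶜ k
...   | yes refl | _ | _ = none k (_ , _ , _ , ox , xy , oy)
...   | no _ | yes refl | _ = none k (_ , _ , _ , oy , yz , oz)
...   | no _ | no _ | yes refl = none k (_ , _ , _ , ox , xz , oz)
...   | no i≢k | no j≢k | no m≢k
        with refl ← both-differ i≢k j≢k | refl ← both-differ i≢k m≢k = none i (_ , _ , _ , xy , yz , xz)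

isGreen-injective : ∀ {i j} → does (i ≟ᶜ green) ≡ does (j ≟ᶜ green) → i ≡ j
isGreen-injective {green} {green} _ = refl
isGreen-injective {red}   {red}   _ = refl

-- Among the five edges from one vertex to five others, three share a colour; these form the claw.
complete-has-triangle : 6 ≤ n → {c : Colouring n} → Complete c → ¬ NoMonoTriangle c
complete-has-triangle {n} 6≤n {c} full =
  let i , j , m , i<j , j<m , p , q = three-alike (λ i → does (proj₁ (spoke i) ≟ᶜ green))
  in triangle-from-claw {c = c} full (apart (<⇒≢ i<j)) (apart (<⇒≢ j<m))
       (apart (<⇒≢ (<-trans i<j j<m)))
       (proj₂ (spoke i)) (recoloured j p) (recoloured m (trans p q))
  where
  vertex : Fin 6 → Fin n
  vertex i = inject≤ i 6≤n
  apart : ∀ {i j : Fin 5} → i ≢ j → vertex (Fin.suc i) ≢ vertex (Fin.suc j)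
  apart i≢j eq = i≢j (suc-injective (inject≤-injective 6≤n 6≤n _ _ eq))
  spoke : ∀ (i : Fin 5) → ∃[ k ] colour c (vertex Fin.zero) (vertex (Fin.suc i)) ≡ just k
  spoke i = full λ eq →
    contradiction (inject≤-injective 6≤n 6≤n Fin.zero (Fin.suc i) eq) λ ()
  recoloured : ∀ {i} j → does (proj₁ (spoke i) ≟ᶜ green) ≡ does (proj₁ (spoke j) ≟ᶜ green) →
    colour c (vertex Fin.zero) (vertex (Fin.suc j)) ≡ just (proj₁ (spoke i))
  recoloured j eq = trans (proj₂ (spoke j)) (cong just (sym (isGreen-injective eq)))

-- This excludes draws: as long as no triangle has appeared, the player to move has an edge to
-- colour.
uncoloured-edge : 6 ≤ n → {c : Colouring n} → NoMonoTriangle c → UncolouredEdge c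
uncoloured-edge 6≤n {c} none
  with any? (λ u → any? λ v → uncoloured? c u v)
... | yes e    = e
... | no taken = contradiction none (complete-has-triangle 6≤n {c} full)
  where
  full : Complete c
  full {x} {y} x≢y with colour c x y in eq
  ... | just k  = k , refl
  ... | nothing = contradiction (x , y , x≢y , eq) taken

-- From winning positions to strategies

green≢red : green ≢ red
green≢red ()

module _ {P : Position n} (6≤n : 6 ≤ n) (moverPII : mover P ≡ PII)
         (w : Wins red green (colouring P)) where

  private
    winning-move : ∀ {c : Colouring n} → Wins red green c ⊎ Holds green red c →
                   UncolouredEdge c → UncolouredEdge c
    winning-move (inj₁ (move e _ _)) _ = e
    -- A default for boards that PII does not win; plays from `P` never reach it.
    winning-move (inj₂ _)            e = e

    σ : Strategy n
    σ c (_ , e) = winning-move (determined (green≢red ∘ sym) c) e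

    -- The invariant along plays of `σ`. PI's last move may have completed a green triangle and
    -- ended the game, so with PII to move a win is claimed only in the absence of one.
    Sound : Player → Colouring n → Set
    Sound PI  c = ¬ Triangle red c × Holds red green c
    Sound PII c = ¬ Triangle green c → Wins red green c

    -- Stated for an arbitrary verdict `d`, so that nothing about how `determined` computes enters;
    -- the wrong verdict is refuted by `Wins-exclusive`.
    winning-move-sound : ∀ {c} → Wins red green c → ∀ d e → Sound PI (paint red c (winning-move d e))
    winning-move-sound _ (inj₁ (move _ safe h)) _ = safe , h
    winning-move-sound w (inj₂ h)               _ = contradiction h (Wins-exclusive w)

    sound : ∀ {m c} → Play PII σ P m c → Sound m c
    sound start = subst (λ m → Sound m (colouring P)) (sym moverPII) λ _ → w
    sound (follow {c} p o) = winning-move-sound (sound p (proj₁ o green)) (determined _ c) _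
    sound (reply p o e) safe with hold h ← proj₂ (sound p) = h e safe

    -- With PI to move, Ramsey's theorem supplies the free edge. With PII to move, the winning move
    -- is itself a free edge, and since it leaves no red triangle there was none before.
    ongoing : ∀ m {c} → Sound m c → ¬ Triangle green c → Ongoing c
    ongoing PI {c} (nr , _) ng = none , uncoloured-edge 6≤n {c} none
      where
      none : NoMonoTriangle c
      none = noMono c ng nr
    ongoing PII {c} s ng with move e safe _ ← s ng =
      noMono c ng (safe ∘ paint-triangle red c e) , e

  Wins⇒IsWinFor : IsWinFor PII P
  Wins⇒IsWinFor = σ , λ {m} {c} p over → decidable-stable (triangle? green c)
    λ ng → over (ongoing m (sound p) ng)

-- A four-cycle of vertices, and triangles in stars

transpose-first : ∀ (i j : Fin n) → transpose i j ⟨$⟩ʳ i ≡ j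
transpose-first i j rewrite dec-true (i ≟ i) refl = refl

transpose-second : ∀ (i j : Fin n) → transpose i j ⟨$⟩ʳ j ≡ i
transpose-second i j with j ≟ i
... | yes j≡i = j≡i
... | no  _ rewrite dec-true (j ≟ j) refl = refl

transpose-else : ∀ {i j x : Fin n} → x ≢ i → x ≢ j → transpose i j ⟨$⟩ʳ x ≡ x
transpose-else {i = i} {j} {x} x≢i x≢j
  rewrite dec-false (x ≟ i) x≢i | dec-false (x ≟ j) x≢j = refl

-- The inverse of the renaming of a, b, c, d to d, c, a, b: it carries vertices of the given
-- position to vertices of `Y`. The factors are applied from left to right.
four-cycle : ∀ {a b c d : Fin n} → Unique (a ∷ b ∷ c ∷ d ∷ []) →
  ∃[ τ ] τ ⟨$⟩ʳ a ≡ c × τ ⟨$⟩ʳ c ≡ b × τ ⟨$⟩ʳ b ≡ d × τ ⟨$⟩ʳ d ≡ a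
four-cycle {a = a} {b} {c} {d}
  ((a≢b ∷ a≢c ∷ a≢d ∷ []) ∷ (b≢c ∷ b≢d ∷ []) ∷ (c≢d ∷ []) ∷ [] ∷ []) =
  transpose a c ∘ₚ transpose a b ∘ₚ transpose a d
  , chain a (transpose-first a c) (transpose-else (≢-sym a≢c) (≢-sym b≢c))
          (transpose-else (≢-sym a≢c) c≢d)
  , chain c (transpose-second a c) (transpose-first a b) (transpose-else (≢-sym a≢b) b≢d)
  , chain b (transpose-else (≢-sym a≢b) b≢c) (transpose-second a b) (transpose-first a d)
  , chain d (transpose-else (≢-sym a≢d) (≢-sym c≢d)) (transpose-else (≢-sym a≢d) (≢-sym b≢d))
          (transpose-second a d)
  where
  chain : ∀ w {x y z} → transpose a c ⟨$⟩ʳ w ≡ x → transpose a b ⟨$⟩ʳ x ≡ y →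
          transpose a d ⟨$⟩ʳ y ≡ z →
          (transpose a c ∘ₚ transpose a b ∘ₚ transpose a d) ⟨$⟩ʳ w ≡ z
  chain w refl refl refl = refl

-- If `d` met all three sides of a triangle, two of its corners would be `d`, making a side a loop.
star-no-triangle : ∀ (c : Colouring n) {d} →
  (∀ {x y} → colour c x y ≡ just k → x ≡ d ⊎ y ≡ d) → ¬ Triangle k c
star-no-triangle {k = k} c {d} star (x , y , z , xy , yz , xz) = meet (star xy) (star yz) (star xz)
  where
  loop : ∀ {x} → colour c x x ≢ just k
  loop {x} eq = contradiction (trans (sym eq) (loopless c x)) λ ()
  meet : x ≡ d ⊎ y ≡ d → y ≡ d ⊎ z ≡ d → x ≡ d ⊎ z ≡ d → _
  meet (inj₁ refl) (inj₁ refl) _           = loop xy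
  meet (inj₁ refl) (inj₂ refl) _           = loop xz
  meet (inj₂ refl) _           (inj₁ refl) = loop xy
  meet (inj₂ refl) _           (inj₂ refl) = loop yz

-- Stealing the strategy in the given position

module _ {κ : Colouring n} {a b c d : Fin n} (distinct : Unique (a ∷ b ∷ c ∷ d ∷ []))
         (tail : GreenPathRedTail κ a b c d) where

  private
    ab = proj₁ tail
    bc = proj₁ (proj₂ tail)
    cd = proj₁ (proj₂ (proj₂ tail))

    only : ∀ {x y k} → colour κ x y ≡ just k →
           SameEdge x y a b ⊎ SameEdge x y b c ⊎ SameEdge x y c d
    only {x} {y} eq = proj₂ (proj₂ (proj₂ tail)) x y
      λ eq′ → contradiction (trans (sym eq) eq′) λ ()

    b≢d : b ≢ d
    b≢d = All.head (All.tail (AllPairs.head (AllPairs.tail distinct)))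

    bd-fresh : colour κ b d ≡ nothing
    bd-fresh with colour κ b d in eq
    ... | nothing = refl
    ... | just _  = contradiction (only eq) (off distinct)
      where
      off : Unique (a ∷ b ∷ c ∷ d ∷ []) →
            ¬ (SameEdge b d a b ⊎ SameEdge b d b c ⊎ SameEdge b d c d)
      off ((_ ∷ _ ∷ a≢d ∷ []) ∷ (b≢c ∷ _) ∷ (c≢d ∷ []) ∷ _) = λ
        { (inj₁ (inj₁ (_ , d≡b)))        → b≢d (sym d≡b)
        ; (inj₁ (inj₂ (_ , d≡a)))        → a≢d (sym d≡a)
        ; (inj₂ (inj₁ (inj₁ (_ , d≡c)))) → c≢d (sym d≡c)
        ; (inj₂ (inj₁ (inj₂ (b≡c , _)))) → b≢c b≡c
        ; (inj₂ (inj₂ (inj₁ (b≡c , _)))) → b≢c b≡c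
        ; (inj₂ (inj₂ (inj₂ (b≡d , _)))) → b≢d b≡d }

    bd : UncolouredEdge κ
    bd = b , d , b≢d , bd-fresh

    Y : Colouring n
    Y = paint red κ bd

    Y-keeps : ∀ {x y k} → colour κ x y ≡ just k → colour Y x y ≡ just k
    Y-keeps = paint-keeps red κ bd

    Y-bd : colour Y b d ≡ just red
    Y-bd = paint-same red κ bd (inj₁ (refl , refl))

    red-only : ∀ {x y} → colour κ x y ≡ just red → SameEdge x y c d
    red-only eq with only eq
    ... | inj₁ s        = contradiction (trans (sym eq) (sameEdge-colour κ s ab)) λ ()
    ... | inj₂ (inj₁ s) = contradiction (trans (sym eq) (sameEdge-colour κ s bc)) λ ()
    ... | inj₂ (inj₂ s) = s

    -- The red edges of `Y` are cd and the new bd, which meet in d; hence bd is a safe move for PII.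
    Y-red-star : ∀ {x y} → colour Y x y ≡ just red → x ≡ d ⊎ y ≡ d
    Y-red-star eq with paint-origin red κ bd eq
    ... | inj₁ (s , _) = end s
      where
      end : ∀ {u x y} → SameEdge x y u d → x ≡ d ⊎ y ≡ d
      end (inj₁ (_ , y≡d)) = inj₂ y≡d
      end (inj₂ (x≡d , _)) = inj₁ x≡d
    ... | inj₂ eq′ with red-only eq′
    ...   | inj₁ (_ , y≡d) = inj₂ y≡d
    ...   | inj₂ (x≡d , _) = inj₁ x≡d

    Y-safe : ¬ Triangle red Y
    Y-safe = star-no-triangle Y Y-red-star

    -- Colours are exchanged: PII plays red on `κ` as PI would play green on `Y`.
    steal : Wins green red Y → Wins red green κ
    steal with τ , τa , τc , τb , τd ← four-cycle distinct =
      simulate-Wins {τ = τ} green≢red (green≢red ∘ sym) record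
        { free = free ; own = own ; theirs = theirs ; closed = λ _ → closed }
      where
      on : ∀ {x y u v u′ v′ m} → τ ⟨$⟩ʳ u ≡ u′ → τ ⟨$⟩ʳ v ≡ v′ → colour Y u′ v′ ≡ m →
           SameEdge x y u v → colour Y (τ ⟨$⟩ʳ x) (τ ⟨$⟩ʳ y) ≡ m
      on τu τv eq s = sameEdge-colour Y (sameEdge-permuted τ τu τv s) eq

      -- `τ` sends the green ab, bc to the red cd, db of `Y`, and the red cd to the green ba. The
      -- remaining green edge bc of `Y` is the image of ca.
      on-ab : ∀ {x y} → SameEdge x y a b → colour Y (τ ⟨$⟩ʳ x) (τ ⟨$⟩ʳ y) ≡ just red
      on-ab = on τa τb (Y-keeps cd)
      on-bc : ∀ {x y} → SameEdge x y b c → colour Y (τ ⟨$⟩ʳ x) (τ ⟨$⟩ʳ y) ≡ just red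
      on-bc = on τb τc (trans (symmetric Y d b) Y-bd)
      on-cd : ∀ {x y} → SameEdge x y c d → colour Y (τ ⟨$⟩ʳ x) (τ ⟨$⟩ʳ y) ≡ just green
      on-cd = on τc τd (trans (symmetric Y b a) (Y-keeps ab))

      from : ∀ {x y u v u′ v′ m} → τ ⟨$⟩ʳ u ≡ u′ → τ ⟨$⟩ʳ v ≡ v′ → colour κ u v ≡ m →
             SameEdge (τ ⟨$⟩ʳ x) (τ ⟨$⟩ʳ y) u′ v′ → colour κ x y ≡ m
      from τu τv eq s = sameEdge-colour κ (permuted-sameEdge τ τu τv s) eq

      from-bd : ∀ {x y} → SameEdge (τ ⟨$⟩ʳ x) (τ ⟨$⟩ʳ y) b d → colour κ x y ≡ just green
      from-bd = from τc τb (trans (symmetric κ c b) bc)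
      from-cd : ∀ {x y} → SameEdge (τ ⟨$⟩ʳ x) (τ ⟨$⟩ʳ y) c d → colour κ x y ≡ just green
      from-cd = from τa τb ab
      from-ab : ∀ {x y} → SameEdge (τ ⟨$⟩ʳ x) (τ ⟨$⟩ʳ y) a b → colour κ x y ≡ just red
      from-ab = from τd τc (trans (symmetric κ d c) cd)

      free : ∀ {x y} → colour Y (τ ⟨$⟩ʳ x) (τ ⟨$⟩ʳ y) ≡ nothing → colour κ x y ≡ nothing
      free {x} {y} eq with colour κ x y in eq′
      ... | nothing = refl
      ... | just _ with only eq′
      ...   | inj₁ s        = contradiction (trans (sym eq) (on-ab s)) λ ()
      ...   | inj₂ (inj₁ s) = contradiction (trans (sym eq) (on-bc s)) λ ()
      ...   | inj₂ (inj₂ s) = contradiction (trans (sym eq) (on-cd s)) λ ()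

      own : ∀ {x y} → colour κ x y ≡ just red → colour Y (τ ⟨$⟩ʳ x) (τ ⟨$⟩ʳ y) ≡ just green
      own = on-cd ∘ red-only

      theirs : ∀ {x y} → colour Y (τ ⟨$⟩ʳ x) (τ ⟨$⟩ʳ y) ≡ just red → colour κ x y ≡ just green
      theirs eq with paint-origin red κ bd eq
      ... | inj₁ (s , _) = from-bd s
      ... | inj₂ eq′     = from-cd (red-only eq′)

      -- Up to τ, only ca is coloured in Y but not in κ; the green path cba closes it.
      closed : ∀ {x y} → colour κ x y ≡ nothing →
               colour Y (τ ⟨$⟩ʳ x) (τ ⟨$⟩ʳ y) ≡ nothing ⊎
               ∃[ z ] colour κ x z ≡ just green × colour κ z y ≡ just green
      closed {x} {y} eq with colour Y (τ ⟨$⟩ʳ x) (τ ⟨$⟩ʳ y) in eq′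
      ... | nothing = inj₁ refl
      ... | just _ with paint-origin red κ bd eq′
      ...   | inj₁ (s , _) = contradiction (trans (sym eq) (from-bd s)) λ ()
      ...   | inj₂ eq″ with only eq″
      ...     | inj₁ s        = contradiction (trans (sym eq) (from-ab s)) λ ()
      ...     | inj₂ (inj₂ s) = contradiction (trans (sym eq) (from-cd s)) λ ()
      ...     | inj₂ (inj₁ s) with permuted-sameEdge τ τc τa s
      ...       | inj₁ (refl , refl) = inj₂ (b , trans (symmetric κ c b) bc , trans (symmetric κ b a) ab)
      ...       | inj₂ (refl , refl) = inj₂ (b , ab , bc)

  GreenPathRedTail⇒Wins : Wins red green κ
  GreenPathRedTail⇒Wins with determined green≢red Y
  ... | inj₁ w = steal w
  ... | inj₂ h = move bd Y-safe h

theorem3 : ∀ (n : ℕ) → n ≥ 6 →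
    (P : Position n) (a b c d : Fin n) →
    Unique (a ∷ b ∷ c ∷ d ∷ []) →
    GreenPathRedTail (colouring P) a b c d →
    mover P ≡ PII →
    IsWinFor PII P
theorem3 n n≥6 P a b c d distinct tail moverPII =
  Wins⇒IsWinFor {P = P} n≥6 moverPII (GreenPathRedTail⇒Wins distinct tail)
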